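{- Let $F$ be a field of characteristic $0$, $G$ a finite group, and let $W,V,V'$ be projective monomial representations of $G$ over $F$, all with the same 2-cocycle, with monomial bases $M_W, M_V, M_{V'}$ respectively. Assume $\mathrm{Hom}_M(V,V')=0$. Let $P_1,\dots,P_r$ be an $F$-basis of $\mathrm{Hom}_M(W,V)$ and $Q_1,\dots,Q_s$ an $F$-basis of $\mathrm{Hom}_M(W,V')$, each consisting of $\{0,-1,1\}$-matrices with pairwise disjoint supports, each supported on a single $G$-orbit of index pairs. Let $x_1,\dots,x_r,y_1,\dots,y_s$ be distinct, not necessarily commuting, indeterminates and put $$A=\sum_{i=1}^r x_iP_i,\qquad B=\sum_{j=1}^s y_jQ_j .$$ Then $(A,B)$ is a Formal Orthogonal Pair with respect to the sets of indeterminates $I=\{x_1,\dots,x_r\}$ and $J=\{y_1,\dots,y_s\}$; in particular $AB^T=0$ over $\mathbb{Z}\{I\cup J\}$.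
   Context: A projective representation of a finite group $G$ over a field $F$ is a finite-dimensional $F$-vector space $V$ with a map $\rho:G\to GL(V)$ such that $\rho(gg')=\omega(g,g')\rho(g)\rho(g')$ for all $g,g'\in G$, where $\omega:G\times G\to\{\pm1\}$ is a 2-cocycle, called the cocycle of $V$. Write $gv$ for $\rho(g)v$. It is monomial, with monomial basis $M$, if $M$ is a basis of $V$ such that for every $g\in G$ and $m\in M$ one has $gm=\pm m'$ for some $m'\in M$. Ignoring signs, $G$ acts by permutations on $M$. A morphism between projective representations with the same cocycle is an $F$-linear map commuting with the action of every $g\in G$. For projective monomial representations $V,V'$ with the same cocycle and monomial bases $M_V,M_{V'}$, $\mathrm{Hom}_M(V,V')$ denotes the $F$-space of matrices representing morphisms $T:V\to V'$ with respect to the monomial bases, with rows indexed by the basis of the target $V'$ and columns by the basis of the source $V$. The orbits of index pairs are the orbits of the diagonal (sign-ignoring) action of $G$ on pairs (row index, column index). Formal Orthogonal Pair: Let $I,J$ be finite disjoint sets of (not necessarily commuting) indeterminates. A Formal Orthogonal Pair is a pair $(A,B)$ of rectangular matrices such that (i) the entries of $A$ are $\pm i$ with $i\in I\cup\{0\}$; (ii) the entries of $B$ are $\pm j$ with $j\in J\cup\{0\}$; (iii) $AB^T=0$, where this equality is over the non-commutative ring $\mathbb{Z}\{I\cup J\}$ generated freely over $\mathbb{Z}$ by the symbols in $I\cup J$, and $B^T$ is the plain transpose. The $\{0,-1,1\}$-matrices $P_i,Q_j$ are regarded as integer matrices when forming $A$ and $B$. -}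

module Defs where

open import Algebra.Apartness.Bundles using (HeytingCommutativeRing; HeytingField)
open import Algebra.Bundles using (CommutativeRing; Group; Ring)
open import Algebra.Core using (Op₁; Op₂)
import Algebra.Construct.Pointwise as Pointwise
import Algebra.Definitions.RawMonoid as RawMonoidDefs
open import Algebra.Module.Bundles using (Module)
import Algebra.Module.Construct.TensorUnit as TensorUnit
open import Algebra.Module.Morphism.Structures using (IsModuleHomomorphism; IsModuleIsomorphism)
open import Algebra.Module.Structures.Biased using (IsModuleFromLeft)
open import Data.Fin.Base using (Fin)
open import Data.Integer.Base using (ℤ; +_; -[1+_]; 0ℤ; 1ℤ; -1ℤ)
open import Data.Maybe.Base using (Maybe; maybe′)
open import Data.Nat.Base using (ℕ; suc)
open import Data.Product.Base using (Σ; ∃; ∃₂; _×_; _,_; proj₁)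
open import Data.Sign.Base as Sign using (Sign)
open import Data.Sum.Base using (_⊎_; inj₁; inj₂)
open import Data.Vec.Functional using (Vector)
open import Function.Bundles using (Inverse)
open import Level using (Level; 0ℓ; _⊔_) renaming (suc to lsuc)
open import Relation.Binary.Core using (Rel)
open import Relation.Binary.PropositionalEquality.Core using (_≡_; _≢_)
open import Relation.Binary.PropositionalEquality.Properties using (setoid)
open import Relation.Unary using (Pred; _∈_; U)

private
  variable
    a c ℓ ℓ₁ ℓ₂ g ℓg m ℓm m′ ℓm′ p : Level

Matrix : Set a → ℕ → ℕ → Set a
Matrix A rows cols = Vector (Vector A cols) rows

------------------------------------------------------------------------
-- Rings

module RingNotation (R : Ring c ℓ) where
  open Ring R
  open RawMonoidDefs +-rawMonoid public using (sum) renaming (_×_ to _·_)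

  fromℤ : ℤ → Carrier
  fromℤ (+ n)    = n · 1#
  fromℤ -[1+ n ] = - (suc n · 1#)

  sgn : Sign → Carrier
  sgn Sign.+ = 1#
  sgn Sign.- = - 1#

  -- The (a , b) entry of Σᵢ xᵢ Pᵢ, for integer matrices Pᵢ.
  formalSum : ∀ {r k n} → Vector Carrier r → Vector (Matrix ℤ k n) r → Matrix Carrier k n
  formalSum x P a b = sum λ i → x i * fromℤ (P i a b)

  -- X Yᵀ, with the plain transpose and no involution on the ring.
  _*ᵀ_ : ∀ {k l n} → Matrix Carrier k n → Matrix Carrier l n → Matrix Carrier k l
  (X *ᵀ Y) a b = sum λ j → X a j * Y b j

------------------------------------------------------------------------
-- Free rings

-- ℤ{X}: ring expressions in the symbols X, modulo the least congruence
-- containing the axioms of a (not necessarily commutative) unital ring.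

infixl 6 _:+_
infixl 7 _:*_
infix  8 :-_
infix  4 _≋_

data Expr (X : Set) : Set where
  var       : X → Expr X
  :0 :1     : Expr X
  _:+_ _:*_ : Op₂ (Expr X)
  :-_       : Op₁ (Expr X)

data _≋_ {X : Set} : Rel (Expr X) 0ℓ where
  ≋-refl  : ∀ {x} → x ≋ x
  ≋-sym   : ∀ {x y} → x ≋ y → y ≋ x
  ≋-trans : ∀ {x y z} → x ≋ y → y ≋ z → x ≋ z

  +-cong : ∀ {x x′ y y′} → x ≋ x′ → y ≋ y′ → x :+ y ≋ x′ :+ y′
  *-cong : ∀ {x x′ y y′} → x ≋ x′ → y ≋ y′ → x :* y ≋ x′ :* y′
  -‿cong : ∀ {x x′} → x ≋ x′ → :- x ≋ :- x′

  +-assoc     : ∀ x y z → (x :+ y) :+ z ≋ x :+ (y :+ z)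
  +-comm      : ∀ x y → x :+ y ≋ y :+ x
  +-identityˡ : ∀ x → :0 :+ x ≋ x
  -‿inverseˡ  : ∀ x → :- x :+ x ≋ :0

  *-assoc     : ∀ x y z → (x :* y) :* z ≋ x :* (y :* z)
  *-identityˡ : ∀ x → :1 :* x ≋ x
  *-identityʳ : ∀ x → x :* :1 ≋ x
  distribˡ    : ∀ x y z → x :* (y :+ z) ≋ x :* y :+ x :* z
  distribʳ    : ∀ x y z → (y :+ z) :* x ≋ y :* x :+ z :* x

freeRing : Set → Ring 0ℓ 0ℓ
freeRing X = record
  { Carrier = Expr X
  ; _≈_     = _≋_
  ; _+_     = _:+_
  ; _*_     = _:*_
  ; -_      = :-_
  ; 0#      = :0
  ; 1#      = :1
  ; isRing  = record
    { +-isAbelianGroup = record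
      { isGroup = record
        { isMonoid = record
          { isSemigroup = record
            { isMagma = record
              { isEquivalence = record { refl = ≋-refl ; sym = ≋-sym ; trans = ≋-trans }
              ; ∙-cong        = +-cong
              }
            ; assoc = +-assoc
            }
          ; identity = +-identityˡ , λ x → ≋-trans (+-comm x :0) (+-identityˡ x)
          }
        ; inverse = -‿inverseˡ , λ x → ≋-trans (+-comm x (:- x)) (-‿inverseˡ x)
        ; ⁻¹-cong = -‿cong
        }
      ; comm = +-comm
      }
    ; *-cong     = *-cong
    ; *-assoc    = *-assoc
    ; *-identity = *-identityˡ , *-identityʳ
    ; distrib    = distribˡ , distribʳ
    }
  }

------------------------------------------------------------------------
-- Formal orthogonal pairs

-- The disjoint finite sets I and J of indeterminates are the two summands
-- of Fin r ⊎ Fin s.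

module _ (r s : ℕ) where
  private
    ℤ⟨I∪J⟩ = freeRing (Fin r ⊎ Fin s)

  open Ring ℤ⟨I∪J⟩ using (Carrier; _≈_; _*_; 0#)
  open RingNotation ℤ⟨I∪J⟩ using (sgn; _*ᵀ_)

  -- `nothing` stands for the extra element of K ∪ {0}.
  SignedSymbolOrZero : {K : Set} → (K → Carrier) → Pred Carrier 0ℓ
  SignedSymbolOrZero {K} symbol e =
    ∃₂ λ (ε : Sign) (k : Maybe K) → e ≈ sgn ε * maybe′ symbol 0# k

  record IsFormalOrthogonalPair {k l n : ℕ} (A : Matrix Carrier k n) (B : Matrix Carrier l n) : Set where
    field
      entriesˡ   : ∀ a b → A a b ∈ SignedSymbolOrZero (λ i → var (inj₁ i))
      entriesʳ   : ∀ a b → B a b ∈ SignedSymbolOrZero (λ j → var (inj₂ j))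
      orthogonal : ∀ a b → (A *ᵀ B) a b ≈ 0#

------------------------------------------------------------------------
-- Fields and vector spaces

module _ (F : HeytingField c ℓ₁ ℓ₂) where

  fieldRing : CommutativeRing c ℓ₁
  fieldRing = HeytingCommutativeRing.commutativeRing (HeytingField.heytingCommutativeRing F)

  CharacteristicZero : Set ℓ₁
  CharacteristicZero = ∀ n → n · 1# ≈ 0# → n ≡ 0
    where
    open CommutativeRing fieldRing using (_≈_; 0#; 1#; ring)
    open RingNotation ring using (_·_)

module _ {R : CommutativeRing c ℓ} where
  open CommutativeRing R using (Carrier; _≈_; 0#)

  module _ (M : Module R m ℓm) where
    open Module M using (Carrierᴹ; _≈ᴹ_; _*ₗ_; 0ᴹ; +ᴹ-rawMonoid)
    open RawMonoidDefs +ᴹ-rawMonoid using (sum)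

    linearCombination : ∀ {n} → Vector Carrier n → Vector Carrierᴹ n → Carrierᴹ
    linearCombination x v = sum λ i → x i *ₗ v i

    -- The family v is a basis of the subspace S of M.
    record IsBasisOf {n} (S : Pred Carrierᴹ p) (v : Vector Carrierᴹ n) : Set (c ⊔ ℓ ⊔ m ⊔ ℓm ⊔ p) where
      field
        members     : ∀ i → v i ∈ S
        independent : ∀ x → linearCombination x v ≈ᴹ 0ᴹ → ∀ i → x i ≈ 0#
        spanning    : ∀ {w} → w ∈ S → ∃ λ x → w ≈ᴹ linearCombination x v

    IsBasis : ∀ {n} → Vector Carrierᴹ n → Set (c ⊔ ℓ ⊔ m ⊔ ℓm)
    IsBasis = IsBasisOf U

    powerModule : ℕ → Module R m ℓm
    powerModule n = record
      { Carrierᴹ = Vector Carrierᴹ n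
      ; _≈ᴹ_     = λ v w → ∀ i → v i ≈ᴹ w i
      ; _+ᴹ_     = λ v w i → v i M.+ᴹ w i
      ; _*ₗ_     = λ x v i → x *ₗ v i
      ; _*ᵣ_     = λ v x i → x *ₗ v i
      ; 0ᴹ       = λ _ → 0ᴹ
      ; -ᴹ_      = λ v i → M.-ᴹ v i
      ; isModule = IsModuleFromLeft.isModule {commutativeRing = R} record
        { isLeftModule = record
          { isLeftSemimodule = record
            { +ᴹ-isCommutativeMonoid = Pointwise.isCommutativeMonoid (Fin n) M.+ᴹ-isCommutativeMonoid
            ; isPreleftSemimodule    = record
              { *ₗ-cong      = λ x≈y v≈w i → M.*ₗ-cong x≈y (v≈w i)
              ; *ₗ-zeroˡ     = λ v i → M.*ₗ-zeroˡ (v i)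
              ; *ₗ-distribʳ  = λ v x y i → M.*ₗ-distribʳ (v i) x y
              ; *ₗ-identityˡ = λ v i → M.*ₗ-identityˡ (v i)
              ; *ₗ-assoc     = λ x y v i → M.*ₗ-assoc x y (v i)
              ; *ₗ-zeroʳ     = λ x i → M.*ₗ-zeroʳ x
              ; *ₗ-distribˡ  = λ x v w i → M.*ₗ-distribˡ x (v i) (w i)
              }
            }
          ; -ᴹ‿cong    = λ v≈w i → M.-ᴹ‿cong (v≈w i)
          ; -ᴹ‿inverse = (λ v i → M.-ᴹ‿inverseˡ (v i)) , λ v i → M.-ᴹ‿inverseʳ (v i)
          }
        }
      }
      where module M = Module M

  matrixModule : ℕ → ℕ → Module R c ℓ
  matrixModule rows cols = powerModule (powerModule TensorUnit.⟨module⟩ cols) rows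

------------------------------------------------------------------------
-- Projective representations

IsFinite : Group g ℓg → Set (g ⊔ ℓg)
IsFinite G = ∃ λ n → Inverse (Group.setoid G) (setoid (Fin n))

record Cocycle (G : Group g ℓg) : Set (g ⊔ ℓg) where
  open Group G
  field
    ω       : Carrier → Carrier → Sign
    ω-cong  : ∀ {x x′ y y′} → x ≈ x′ → y ≈ y′ → ω x y ≡ ω x′ y′
    cocycle : ∀ x y z → ω x y Sign.* ω (x ∙ y) z ≡ ω y z Sign.* ω x (y ∙ z)

module _ (F : HeytingField c ℓ₁ ℓ₂) {G : Group g ℓg} (C : Cocycle G) where
  private
    R = fieldRing F
    module G = Group G

  open Cocycle C
  open RingNotation (CommutativeRing.ring R) using (sgn)

  record ProjectiveRepresentation m ℓm : Set (c ⊔ ℓ₁ ⊔ g ⊔ ℓg ⊔ lsuc (m ⊔ ℓm)) where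
    field
      space : Module R m ℓm

    open Module space public

    field
      finiteDimensional : ∃ λ n → Σ (Vector Carrierᴹ n) (IsBasis space)
      ρ                 : G.Carrier → Carrierᴹ → Carrierᴹ
      ρ-cong            : ∀ {x y} → x G.≈ y → ∀ v → ρ x v ≈ᴹ ρ y v
      ρ-isIsomorphism   : ∀ x → IsModuleIsomorphism rawModule rawModule (ρ x)
      ρ-∙               : ∀ x y v → ρ (x G.∙ y) v ≈ᴹ sgn (ω x y) *ₗ ρ x (ρ y v)

  record ProjectiveMonomialRepresentation m ℓm : Set (c ⊔ ℓ₁ ⊔ g ⊔ ℓg ⊔ lsuc (m ⊔ ℓm)) where
    field
      projectiveRepresentation : ProjectiveRepresentation m ℓm

    open ProjectiveRepresentation projectiveRepresentation public

    field
      dim      : ℕ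
      basis    : Vector Carrierᴹ dim
      isBasis  : IsBasis space basis
      monomial : ∀ x i → ∃₂ λ (j : Fin dim) (ε : Sign) → ρ x (basis i) ≈ᴹ sgn ε *ₗ basis j

    -- The action on the indices of the monomial basis, ignoring signs.
    act : G.Carrier → Fin dim → Fin dim
    act x i = proj₁ (monomial x i)

module _ {F : HeytingField c ℓ₁ ℓ₂} {G : Group g ℓg} {C : Cocycle G} where
  private
    R = fieldRing F
    module R = CommutativeRing R

  record IsMorphism
    (V : ProjectiveRepresentation F C m ℓm) (V′ : ProjectiveRepresentation F C m′ ℓm′)
    (φ : ProjectiveRepresentation.Carrierᴹ V → ProjectiveRepresentation.Carrierᴹ V′)
    : Set (c ⊔ g ⊔ m ⊔ ℓm ⊔ ℓm′) where
    private
      module V  = ProjectiveRepresentation V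
      module V′ = ProjectiveRepresentation V′
    field
      isLinear : IsModuleHomomorphism V.rawModule V′.rawModule φ
      commutes : ∀ x v → φ (V.ρ x v) V′.≈ᴹ V′.ρ x (φ v)

  module _ (V : ProjectiveMonomialRepresentation F C m ℓm) (V′ : ProjectiveMonomialRepresentation F C m′ ℓm′) where
    private
      module V  = ProjectiveMonomialRepresentation V
      module V′ = ProjectiveMonomialRepresentation V′

    -- Column b of T holds the coordinates of the image of the b-th basis vector of the source V.
    Represents : Matrix R.Carrier V′.dim V.dim → (V.Carrierᴹ → V′.Carrierᴹ) → Set ℓm′
    Represents T φ = ∀ b → φ (V.basis b) V′.≈ᴹ linearCombination V′.space (λ a → T a b) V′.basis

    HomM : Pred (Matrix R.Carrier V′.dim V.dim) (c ⊔ g ⊔ m ⊔ ℓm ⊔ m′ ⊔ ℓm′)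
    HomM T = ∃ λ φ → IsMorphism V.projectiveRepresentation V′.projectiveRepresentation φ × Represents T φ

    ambientSpace : Module R c ℓ₁
    ambientSpace = matrixModule V′.dim V.dim

    HomMIsZero : Set (c ⊔ ℓ₁ ⊔ g ⊔ m ⊔ ℓm ⊔ m′ ⊔ ℓm′)
    HomMIsZero = ∀ {T} → T ∈ HomM → T ≈ᴹ 0ᴹ
      where open Module ambientSpace using (_≈ᴹ_; 0ᴹ)

    IsHomMBasis : ∀ {r} → Vector (Matrix ℤ V′.dim V.dim) r → Set (c ⊔ ℓ₁ ⊔ g ⊔ m ⊔ ℓm ⊔ m′ ⊔ ℓm′)
    IsHomMBasis P = IsBasisOf ambientSpace HomM λ i a b → fromℤ (P i a b)
      where open RingNotation R.ring using (fromℤ)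

    IndexPair : Set
    IndexPair = Fin V′.dim × Fin V.dim

    orbit : IndexPair → Pred IndexPair g
    orbit (a , b) (a′ , b′) = ∃ λ x → V′.act x a ≡ a′ × V.act x b ≡ b′

    SupportedOnOrbit : Pred (Matrix ℤ V′.dim V.dim) g
    SupportedOnOrbit T = ∃ λ o → ∀ a b → T a b ≢ 0ℤ → (a , b) ∈ orbit o

------------------------------------------------------------------------
-- Sign matrices

module _ {rows cols : ℕ} where

  IsSignMatrix : Pred (Matrix ℤ rows cols) 0ℓ
  IsSignMatrix T = ∀ a b → T a b ≡ 0ℤ ⊎ T a b ≡ 1ℤ ⊎ T a b ≡ -1ℤ

  DisjointSupports : ∀ {r} → Pred (Vector (Matrix ℤ rows cols) r) 0ℓ
  DisjointSupports P = ∀ i j → i ≢ j → ∀ a b → P i a b ≢ 0ℤ → P j a b ≡ 0ℤ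

{-# OPTIONS --safe #-}
module Submission where

-- The matrices of G in monomial bases are signed permutation matrices, hence
-- orthogonal, so transposing turns a morphism W → V into a morphism V → W.
-- Each Qⱼ Pᵢᵀ therefore lies in Hom_M(V , V′) = 0, and in characteristic 0
-- this already gives Pᵢ Qⱼᵀ = 0 over ℤ. Since integers are central in
-- ℤ{I ∪ J}, A Bᵀ = Σᵢⱼ xᵢ yⱼ (Pᵢ Qⱼᵀ) = 0.

open import Algebra.Apartness.Bundles using (HeytingField)
open import Algebra.Bundles using (CommutativeMonoid; CommutativeRing; Group; Ring)
open import Algebra.Module.Bundles using (Module)
open import Algebra.Module.Morphism.Structures using (IsModuleHomomorphism; IsModuleIsomorphism)
import Algebra.Module.Properties as ModuleProperties
import Algebra.Properties.AbelianGroup as AbelianGroupProperties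
import Algebra.Properties.CommutativeMonoid.Sum as CommutativeMonoidSum
import Algebra.Properties.Monoid.Mult as MonoidMult
import Algebra.Properties.Ring as RingProperties
import Algebra.Properties.Semiring.Mult as SemiringMult
import Algebra.Properties.Semiring.Sum as SemiringSum
import Algebra.Solver.CommutativeMonoid as CommutativeMonoidSolver
open import Data.Fin.Base using (Fin; punchOut)
open import Data.Fin.Permutation using (Permutation′; permutation; _⟨$⟩ʳ_; _⟨$⟩ˡ_; inverseˡ)
open import Data.Fin.Properties using (_≟_; any?; injective⇒≤; punchInᵢ≢i; punchOut-injective)
open import Data.Integer.Base as ℤ using (ℤ; +_; -[1+_]; _◃_; _⊖_; 0ℤ; 1ℤ; -1ℤ; ∣_∣; sign)
import Data.Integer.Properties as ℤ
open import Data.Maybe.Base using (just; nothing)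
open import Data.Nat.Base as ℕ using (ℕ; zero; suc)
import Data.Nat.Properties as ℕ
open import Data.Product.Base using (∃; _,_; proj₁; proj₂)
open import Data.Sign.Base as Sign using (Sign)
open import Data.Sum.Base using (_⊎_; inj₁; inj₂)
open import Data.Unit.Base using (tt)
open import Data.Vec.Functional using (Vector; removeAt; replicate; updateAt)
open import Data.Vec.Functional.Properties using (updateAt-updates; updateAt-minimal)
open import Function.Base using (_∘_; const)
open import Function.Definitions using (Injective)
open import Level using (Level)
open import Relation.Binary.PropositionalEquality as ≡ using (_≡_; _≢_)
import Relation.Binary.Reasoning.Setoid as SetoidReasoning
open import Relation.Nullary using (yes; no; ¬?; contradiction)
open import Relation.Nullary.Decidable using (decidable-stable)
open import Defs hiding
  ( +-assoc; +-comm; +-cong; +-identityˡ; -‿cong; -‿inverseˡ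
  ; *-assoc; *-cong; *-identityˡ; *-identityʳ; distribˡ; distribʳ
  )

private
  variable
    c ℓ ℓ₁ ℓ₂ g ℓg m ℓm m′ ℓm′ m₀ ℓm₀ m₁ ℓm₁ m₂ ℓm₂ : Level

-- Injective self-maps of finite sets

-- Pigeonhole: if `j` were missed, punching `j` out of the codomain would give an injection from
-- `Fin (suc n)` into `Fin n`.
injective⇒surjective : ∀ {n} {f : Fin n → Fin n} → Injective _≡_ _≡_ f → ∀ j → ∃ λ i → f i ≡ j
injective⇒surjective {suc n} {f} f-injective j with any? (λ i → f i ≟ j)
... | yes i,fi≡j = i,fi≡j
... | no ∄i      = contradiction (injective⇒≤ g-injective) ℕ.1+n≰n
  where
  j≢f : ∀ i → j ≢ f i
  j≢f i j≡fi = ∄i (i , ≡.sym j≡fi)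

  g-injective : Injective _≡_ _≡_ (λ i → punchOut (j≢f i))
  g-injective = f-injective ∘ punchOut-injective (j≢f _) (j≢f _)

-- The forward map is `f` itself, so for `actPermutation` below `⟨$⟩ʳ` unfolds to `act x` and
-- reindexed sums have the expected form by computation.
injective⇒permutation : ∀ {n} (f : Fin n → Fin n) → Injective _≡_ _≡_ f → Permutation′ n
injective⇒permutation f f-injective =
  permutation f (λ j → proj₁ (f-surjective j)) (λ j → proj₂ (f-surjective j))
    (λ i → f-injective (proj₂ (f-surjective (f i))))
  where f-surjective = injective⇒surjective f-injective

-- Sums with at most one nonzero term

module _ (M : CommutativeMonoid c ℓ) where
  open CommutativeMonoid M
  open CommutativeMonoidSum M using (sum; sum-remove; sum-cong-≋; sum-replicate-zero)
  open SetoidReasoning setoid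

  sum-zero : ∀ {n} {f : Vector Carrier n} → (∀ i → f i ≈ ε) → sum f ≈ ε
  sum-zero {n} f≈ε = trans (sum-cong-≋ f≈ε) (sum-replicate-zero n)

  sum-single : ∀ {n} (f : Vector Carrier n) j → (∀ i → i ≢ j → f i ≈ ε) → sum f ≈ f j
  sum-single {suc n} f j f≈ε = begin
    sum f                      ≈⟨ sum-remove f ⟩
    f j ∙ sum (removeAt f j)   ≈⟨ ∙-congˡ (sum-zero λ i → f≈ε _ (punchInᵢ≢i j i)) ⟩
    f j ∙ ε                    ≈⟨ identityʳ (f j) ⟩
    f j                        ∎

-- Integers in a possibly noncommutative ring, and products of formal sums

module RingLemmas (R : Ring c ℓ) where
  open Ring R
  open RingNotation R
  open RingProperties R
  open AbelianGroupProperties +-abelianGroup using (⁻¹-∙-comm)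
  open MonoidMult +-monoid using (×-congʳ; ×-homo-+)
  open SemiringMult semiring using (×-comm-*; ×-assoc-*; ×1-homo-*)
  open SemiringSum semiring using (sum-cong-≋; ∑-comm; *-distribˡ-sum; *-distribʳ-sum)
  open SetoidReasoning setoid

  private
    module ℤSums = RingNotation ℤ.+-*-ring

  sgn-square : ∀ s → sgn s * sgn s ≈ 1#
  sgn-square Sign.+ = *-identityˡ 1#
  sgn-square Sign.- = trans (-1*x≈-x (- 1#)) (-‿involutive 1#)

  sgn-homo-* : ∀ s t → sgn (s Sign.* t) ≈ sgn s * sgn t
  sgn-homo-* Sign.+ t      = sym (*-identityˡ (sgn t))
  sgn-homo-* Sign.- Sign.+ = sym (*-identityʳ (- 1#))
  sgn-homo-* Sign.- Sign.- = sym (sgn-square Sign.-)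

  ·-central : ∀ n x → x * (n · 1#) ≈ (n · 1#) * x
  ·-central n x = begin
    x * (n · 1#)   ≈⟨ ×-comm-* n x 1# ⟩
    n · (x * 1#)   ≈⟨ ×-congʳ n (trans (*-identityʳ x) (sym (*-identityˡ x))) ⟩
    n · (1# * x)   ≈⟨ ×-assoc-* n 1# x ⟨
    (n · 1#) * x   ∎

  -- An integer is a signed sum of copies of `1#`, so it commutes with everything. This lets integer
  -- entries pass the indeterminates of the free ring.
  fromℤ-central : ∀ z x → x * fromℤ z ≈ fromℤ z * x
  fromℤ-central (+ n)    x = ·-central n x
  fromℤ-central -[1+ n ] x = begin
    x * - (suc n · 1#)     ≈⟨ -‿distribʳ-* x (suc n · 1#) ⟨
    - (x * (suc n · 1#))   ≈⟨ -‿cong (·-central (suc n) x) ⟩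
    - ((suc n · 1#) * x)   ≈⟨ -‿distribˡ-* (suc n · 1#) x ⟩
    - (suc n · 1#) * x     ∎

  fromℤ-homo-⊖ : ∀ m n → fromℤ (m ⊖ n) ≈ m · 1# - n · 1#
  fromℤ-homo-⊖ zero    zero    = sym (-‿inverseʳ 0#)
  fromℤ-homo-⊖ zero    (suc n) = sym (+-identityˡ _)
  fromℤ-homo-⊖ (suc m) zero    = sym (trans (+-congˡ -0#≈0#) (+-identityʳ _))
  fromℤ-homo-⊖ (suc m) (suc n) = begin
    fromℤ (suc m ⊖ suc n)              ≡⟨ ≡.cong fromℤ (ℤ.[1+m]⊖[1+n]≡m⊖n m n) ⟩
    fromℤ (m ⊖ n)                      ≈⟨ fromℤ-homo-⊖ m n ⟩
    -- Insert 0 = 1 - 1; each multiple then absorbs one of the two units.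
    m · 1# - n · 1#                    ≈⟨ +-congˡ (+-identityˡ _) ⟨
    m · 1# + (0# - n · 1#)             ≈⟨ +-congˡ (+-congʳ (-‿inverseʳ 1#)) ⟨
    m · 1# + (1# - 1# - n · 1#)        ≈⟨ +-congˡ (+-assoc 1# (- 1#) _) ⟩
    m · 1# + (1# + (- 1# - n · 1#))    ≈⟨ +-assoc _ 1# _ ⟨
    m · 1# + 1# + (- 1# - n · 1#)      ≈⟨ +-cong (+-comm _ 1#) (⁻¹-∙-comm 1# _) ⟩
    suc m · 1# - suc n · 1#            ∎

  fromℤ-homo-+ : ∀ y z → fromℤ (y ℤ.+ z) ≈ fromℤ y + fromℤ z
  fromℤ-homo-+ (+ m)    (+ n)    = ×-homo-+ 1# m n
  fromℤ-homo-+ (+ m)    -[1+ n ] = fromℤ-homo-⊖ m (suc n)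
  fromℤ-homo-+ -[1+ m ] (+ n)    = trans (fromℤ-homo-⊖ n (suc m)) (+-comm _ _)
  fromℤ-homo-+ -[1+ m ] -[1+ n ] = begin
    -- The sum of `-[1+ m ]` and `-[1+ n ]` computes to `-[1+ suc (m + n) ]`, so one `suc` has to be
    -- moved onto the second summand.
    - (suc (suc (m ℕ.+ n)) · 1#)      ≡⟨ ≡.cong (λ k → - (suc k · 1#)) (ℕ.+-suc m n) ⟨
    - ((suc m ℕ.+ suc n) · 1#)        ≈⟨ -‿cong (×-homo-+ 1# (suc m) (suc n)) ⟩
    - (suc m · 1# + suc n · 1#)       ≈⟨ ⁻¹-∙-comm _ _ ⟨
    - (suc m · 1#) - suc n · 1#       ∎

  fromℤ-◃ : ∀ s n → fromℤ (s ◃ n) ≈ sgn s * (n · 1#)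
  fromℤ-◃ s      zero    = sym (zeroʳ (sgn s))
  fromℤ-◃ Sign.+ (suc n) = sym (*-identityˡ _)
  fromℤ-◃ Sign.- (suc n) = sym (-1*x≈-x _)

  -- Integer multiplication is defined through sign and absolute value. Signs and absolute values
  -- are multiplicative separately, and centrality of `k · 1#` restores the interleaved order.
  fromℤ-homo-* : ∀ y z → fromℤ (y ℤ.* z) ≈ fromℤ y * fromℤ z
  fromℤ-homo-* y z = begin
    fromℤ (y ℤ.* z)                              ≈⟨ fromℤ-◃ (s Sign.* t) (k ℕ.* n) ⟩
    sgn (s Sign.* t) * ((k ℕ.* n) · 1#)          ≈⟨ *-cong (sgn-homo-* s t) (×1-homo-* k n) ⟩
    sgn s * sgn t * ((k · 1#) * (n · 1#))        ≈⟨ *-assoc _ _ _ ⟩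
    sgn s * (sgn t * ((k · 1#) * (n · 1#)))      ≈⟨ *-congˡ (*-assoc _ _ _) ⟨
    sgn s * (sgn t * (k · 1#) * (n · 1#))        ≈⟨ *-congˡ (*-congʳ (·-central k (sgn t))) ⟩
    sgn s * ((k · 1#) * sgn t * (n · 1#))        ≈⟨ *-congˡ (*-assoc _ _ _) ⟩
    sgn s * ((k · 1#) * (sgn t * (n · 1#)))      ≈⟨ *-assoc _ _ _ ⟨
    sgn s * (k · 1#) * (sgn t * (n · 1#))        ≈⟨ *-cong (fromℤ-◃ s k) (fromℤ-◃ t n) ⟨
    fromℤ (s ◃ k) * fromℤ (t ◃ n)                ≡⟨ ≡.cong₂ (λ y z → fromℤ y * fromℤ z) (ℤ.◃-inverse y) (ℤ.◃-inverse z) ⟩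
    fromℤ y * fromℤ z                            ∎
    where
    s = sign y
    t = sign z
    k = ∣ y ∣
    n = ∣ z ∣

  fromℤ-homo-sum : ∀ {n} (f : Vector ℤ n) → fromℤ (ℤSums.sum f) ≈ sum (fromℤ ∘ f)
  fromℤ-homo-sum {zero}  f = refl
  fromℤ-homo-sum {suc n} f =
    trans (fromℤ-homo-+ (f Fin.zero) _) (+-congˡ (fromℤ-homo-sum (f ∘ Fin.suc)))

  fromMatrixℤ : ∀ {k n} → Matrix ℤ k n → Matrix Carrier k n
  fromMatrixℤ X a b = fromℤ (X a b)

  fromℤ-homo-*ᵀ : ∀ {k l n} (X : Matrix ℤ k n) (Y : Matrix ℤ l n) a b →
                  fromℤ ((X ℤSums.*ᵀ Y) a b) ≈ (fromMatrixℤ X *ᵀ fromMatrixℤ Y) a b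
  fromℤ-homo-*ᵀ X Y a b = trans (fromℤ-homo-sum (λ j → X a j ℤ.* Y b j))
    (sum-cong-≋ λ j → fromℤ-homo-* (X a j) (Y b j))

  -- Distributing and exchanging sums makes the column index `h` innermost. For fixed `i` and `j`,
  -- centrality moves the integer entries to the right while `x i * y j` keeps its order, and the
  -- sum over `h` becomes an entry of an integer matrix product.
  formalSum-*ᵀ : ∀ {r s k l n} (x : Vector Carrier r) (y : Vector Carrier s)
                 (P : Vector (Matrix ℤ k n) r) (Q : Vector (Matrix ℤ l n) s) a b →
                 (formalSum x P *ᵀ formalSum y Q) a b
                   ≈ sum (λ i → sum λ j → x i * y j * fromℤ ((P i ℤSums.*ᵀ Q j) a b))
  formalSum-*ᵀ x y P Q a b = begin
    sum (λ h → sum (λ i → p i h) * sum (λ j → q j h))        ≈⟨ sum-cong-≋ (λ h → *-distribʳ-sum _ (λ i → p i h)) ⟩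
    sum (λ h → sum λ i → p i h * sum (λ j → q j h))          ≈⟨ sum-cong-≋ (λ h → sum-cong-≋ λ i → *-distribˡ-sum (p i h) (λ j → q j h)) ⟩
    sum (λ h → sum λ i → sum λ j → p i h * q j h)            ≈⟨ ∑-comm (λ h i → sum λ j → p i h * q j h) ⟩
    sum (λ i → sum λ h → sum λ j → p i h * q j h)            ≈⟨ sum-cong-≋ (λ i → ∑-comm (λ h j → p i h * q j h)) ⟩
    sum (λ i → sum λ j → sum λ h → p i h * q j h)            ≈⟨ sum-cong-≋ (λ i → sum-cong-≋ λ j → collect i j) ⟩
    sum (λ i → sum λ j → x i * y j * fromℤ ((P i ℤSums.*ᵀ Q j) a b)) ∎
    where
    p = λ i h → x i * fromℤ (P i a h)
    q = λ j h → y j * fromℤ (Q j b h)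

    interchange : ∀ u v (y z : ℤ) → u * fromℤ y * (v * fromℤ z) ≈ u * v * fromℤ (y ℤ.* z)
    interchange u v y z = begin
      u * fromℤ y * (v * fromℤ z)     ≈⟨ *-assoc _ _ _ ⟩
      u * (fromℤ y * (v * fromℤ z))   ≈⟨ *-congˡ (*-assoc _ _ _) ⟨
      u * (fromℤ y * v * fromℤ z)     ≈⟨ *-congˡ (*-congʳ (fromℤ-central y v)) ⟨
      u * (v * fromℤ y * fromℤ z)     ≈⟨ *-congˡ (*-assoc _ _ _) ⟩
      u * (v * (fromℤ y * fromℤ z))   ≈⟨ *-assoc _ _ _ ⟨
      u * v * (fromℤ y * fromℤ z)     ≈⟨ *-congˡ (fromℤ-homo-* y z) ⟨
      u * v * fromℤ (y ℤ.* z)         ∎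

    collect : ∀ i j → sum (λ h → p i h * q j h) ≈ x i * y j * fromℤ ((P i ℤSums.*ᵀ Q j) a b)
    collect i j = begin
      sum (λ h → p i h * q j h)                              ≈⟨ sum-cong-≋ (λ h → interchange (x i) (y j) (P i a h) (Q j b h)) ⟩
      sum (λ h → x i * y j * fromℤ (P i a h ℤ.* Q j b h))    ≈⟨ *-distribˡ-sum (x i * y j) (λ h → fromℤ (P i a h ℤ.* Q j b h)) ⟨
      x i * y j * sum (λ h → fromℤ (P i a h ℤ.* Q j b h))    ≈⟨ *-congˡ (fromℤ-homo-sum (λ h → P i a h ℤ.* Q j b h)) ⟨
      x i * y j * fromℤ ((P i ℤSums.*ᵀ Q j) a b)             ∎

  *-fromℤ-zero : ∀ x {z} → z ≡ 0ℤ → x * fromℤ z ≈ 0#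
  *-fromℤ-zero x ≡.refl = zeroʳ x

  fromℤ-signed : ∀ z → z ≡ 0ℤ ⊎ z ≡ 1ℤ ⊎ z ≡ -1ℤ → z ≢ 0ℤ → ∃ λ ε → fromℤ z ≈ sgn ε
  fromℤ-signed z (inj₁ z≡0)             z≢0 = contradiction z≡0 z≢0
  -- `fromℤ 1ℤ` unfolds to `1# + 0#`, hence the right identity law.
  fromℤ-signed z (inj₂ (inj₁ ≡.refl))   z≢0 = Sign.+ , +-identityʳ 1#
  fromℤ-signed z (inj₂ (inj₂ ≡.refl))   z≢0 = Sign.- , -‿cong (+-identityʳ 1#)

-- Entries of formal sums

module _ (r s : ℕ) where
  open Ring (freeRing (Fin r ⊎ Fin s)) hiding (zero)
  open RingNotation (freeRing (Fin r ⊎ Fin s))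
  open RingLemmas (freeRing (Fin r ⊎ Fin s)) using (*-fromℤ-zero; fromℤ-central; fromℤ-signed)
  open SetoidReasoning setoid

  -- Disjoint supports leave at most one nonzero summand at each position, found by a finite search.
  -- The family `x` is arbitrary, so the lemma serves both matrices of the pair.
  formalSum-signedSymbolOrZero : ∀ {t k n} (x : Vector Carrier t) (P : Vector (Matrix ℤ k n) t) →
                                 (∀ i → IsSignMatrix (P i)) → DisjointSupports P →
                                 ∀ a b → SignedSymbolOrZero r s x (formalSum x P a b)
  formalSum-signedSymbolOrZero x P isSign disjoint a b with any? (λ i → ¬? (P i a b ℤ.≟ 0ℤ))
  -- The sign of a zero entry is arbitrary; `+` is a default.
  ... | no ∄i = Sign.+ , nothing , (begin
    formalSum x P a b   ≈⟨ sum-zero +-commutativeMonoid (λ i → *-fromℤ-zero (x i) (decidable-stable (P i a b ℤ.≟ 0ℤ) λ Pi≢0 → ∄i (i , Pi≢0))) ⟩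
    0#                  ≈⟨ zeroʳ _ ⟨
    1# * 0#             ∎)
  ... | yes (i , Pi≢0) with fromℤ-signed (P i a b) (isSign i a b) Pi≢0
  ...   | ε , Pi≈ε = ε , just i , (begin
    formalSum x P a b       ≈⟨ sum-single +-commutativeMonoid (λ j → x j * fromℤ (P j a b)) i
                                 (λ j j≢i → *-fromℤ-zero (x j) (disjoint i j (j≢i ∘ ≡.sym) a b Pi≢0)) ⟩
    x i * fromℤ (P i a b)   ≈⟨ fromℤ-central (P i a b) (x i) ⟩
    fromℤ (P i a b) * x i   ≈⟨ *-congʳ Pi≈ε ⟩
    sgn ε * x i             ∎)

-- Linear combinations in a module

module _ {R : CommutativeRing c ℓ} where
  private
    module R where
      open CommutativeRing R public
      open RingNotation ring public
      open RingLemmas ring public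

  module LinearCombinations (M : Module R m ℓm) where
    open Module M
    open CommutativeMonoidSum +ᴹ-commutativeMonoid using (sum; sum-cong-≋; ∑-distrib-+; sum-permute)
    open SetoidReasoning ≈ᴹ-setoid

    private
      lc : ∀ {n} → Vector R.Carrier n → Vector Carrierᴹ n → Carrierᴹ
      lc = linearCombination M

    sgn-square-*ₗ : ∀ s v → R.sgn s *ₗ (R.sgn s *ₗ v) ≈ᴹ v
    sgn-square-*ₗ s v = begin
      R.sgn s *ₗ (R.sgn s *ₗ v)   ≈⟨ *ₗ-assoc _ _ v ⟨
      (R.sgn s R.* R.sgn s) *ₗ v  ≈⟨ *ₗ-congʳ (R.sgn-square s) ⟩
      R.1# *ₗ v                   ≈⟨ *ₗ-identityˡ v ⟩
      v                           ∎

    linearCombination-congˡ : ∀ {n} {x y : Vector R.Carrier n} {v} → (∀ i → x i R.≈ y i) → lc x v ≈ᴹ lc y v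
    linearCombination-congˡ x≈y = sum-cong-≋ λ i → *ₗ-congʳ (x≈y i)

    linearCombination-congʳ : ∀ {n} {x : Vector R.Carrier n} {v w} → (∀ i → v i ≈ᴹ w i) → lc x v ≈ᴹ lc x w
    linearCombination-congʳ v≈w = sum-cong-≋ λ i → *ₗ-congˡ (v≈w i)

    linearCombination-zero : ∀ {n} {x : Vector R.Carrier n} {v} → (∀ i → x i R.≈ R.0#) → lc x v ≈ᴹ 0ᴹ
    linearCombination-zero {v = v} x≈0 =
      sum-zero +ᴹ-commutativeMonoid λ i → ≈ᴹ-trans (*ₗ-congʳ (x≈0 i)) (*ₗ-zeroˡ (v i))

    linearCombination-+ : ∀ {n} (x y : Vector R.Carrier n) v → lc (λ i → x i R.+ y i) v ≈ᴹ lc x v +ᴹ lc y v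
    linearCombination-+ x y v = ≈ᴹ-trans (sum-cong-≋ λ i → *ₗ-distribʳ (v i) (x i) (y i))
      (∑-distrib-+ (λ i → x i *ₗ v i) (λ i → y i *ₗ v i))

    *ₗ-linearCombination : ∀ {n} s (x : Vector R.Carrier n) v → s *ₗ lc x v ≈ᴹ lc (λ i → s R.* x i) v
    *ₗ-linearCombination {zero}  s x v = *ₗ-zeroʳ s
    *ₗ-linearCombination {suc n} s x v = ≈ᴹ-trans (*ₗ-distribˡ s _ _)
      (+ᴹ-cong (≈ᴹ-sym (*ₗ-assoc s _ _)) (*ₗ-linearCombination s (x ∘ Fin.suc) (v ∘ Fin.suc)))

    linearCombination-*ₗ : ∀ {n} (x y : Vector R.Carrier n) v →
                           lc x (λ i → y i *ₗ v i) ≈ᴹ lc (λ i → x i R.* y i) v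
    linearCombination-*ₗ x y v = sum-cong-≋ λ i → ≈ᴹ-sym (*ₗ-assoc (x i) (y i) (v i))

    linearCombination-permute : ∀ {n} (x : Vector R.Carrier n) v (π : Permutation′ n) →
                                lc x v ≈ᴹ lc (λ i → x (π ⟨$⟩ʳ i)) (λ i → v (π ⟨$⟩ʳ i))
    linearCombination-permute x v = sum-permute (λ i → x i *ₗ v i)

    single : ∀ {n} → Fin n → R.Carrier → Vector R.Carrier n
    single {n} i s = updateAt (replicate n R.0#) i (const s)

    single-≡ : ∀ {n} (i : Fin n) s → single i s i R.≈ s
    single-≡ {n} i s = R.reflexive (updateAt-updates i (replicate n R.0#))

    single-≢ : ∀ {n} {i j : Fin n} s → j ≢ i → single i s j R.≈ R.0#
    single-≢ {n} {i} {j} s j≢i = R.reflexive (updateAt-minimal j i (replicate n R.0#) j≢i)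

    linearCombination-single : ∀ {n} (i : Fin n) s v → lc (single i s) v ≈ᴹ s *ₗ v i
    linearCombination-single i s v = ≈ᴹ-trans
      (sum-single +ᴹ-commutativeMonoid (λ j → single i s j *ₗ v j) i
        (λ j j≢i → ≈ᴹ-trans (*ₗ-congʳ (single-≢ s j≢i)) (*ₗ-zeroˡ (v j))))
      (*ₗ-congʳ (single-≡ i s))

  -- Coordinates in a basis

  module Coordinates (M : Module R m ℓm) {n} {b : Vector (Module.Carrierᴹ M) n} (b-isBasis : IsBasis M b) where
    open Module M
    open LinearCombinations M
    open IsBasisOf b-isBasis
    open SetoidReasoning ≈ᴹ-setoid

    private
      lc : Vector R.Carrier n → Vector Carrierᴹ n → Carrierᴹ
      lc = linearCombination M

    -- This is the witness chosen by `spanning`. That the choice respects `≈ᴹ` follows only from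
    -- `coordinates-unique`.
    coordinates : Carrierᴹ → Vector R.Carrier n
    coordinates v = proj₁ (spanning {v} tt)

    coordinates-spec : ∀ v → v ≈ᴹ lc (coordinates v) b
    coordinates-spec v = proj₂ (spanning {v} tt)

    -- Independence is applied to the differences `x i - y i`; replacing the combination of `x` by
    -- that of `y` turns their combination into that of `y i - y i`.
    coordinates-unique : ∀ x y → lc x b ≈ᴹ lc y b → ∀ i → x i R.≈ y i
    coordinates-unique x y x≈y i =
      x+-y≈0⇒x≈y (x i) (y i) (independent (λ i → x i R.- y i) x-y≈0 i)
      where
      open AbelianGroupProperties R.+-abelianGroup using () renaming (x∙y⁻¹≈ε⇒x≈y to x+-y≈0⇒x≈y)
      x-y≈0 : lc (λ i → x i R.- y i) b ≈ᴹ 0ᴹ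
      x-y≈0 = begin
        lc (λ i → x i R.- y i) b          ≈⟨ linearCombination-+ x (λ i → R.- y i) b ⟩
        lc x b +ᴹ lc (λ i → R.- y i) b    ≈⟨ +ᴹ-congʳ x≈y ⟩
        lc y b +ᴹ lc (λ i → R.- y i) b    ≈⟨ linearCombination-+ y (λ i → R.- y i) b ⟨
        lc (λ i → y i R.- y i) b          ≈⟨ linearCombination-zero (λ i → R.-‿inverseʳ (y i)) ⟩
        0ᴹ                                ∎

    -- Pulling both coefficient families back along the inverse of `π` reduces this to the original
    -- basis, where they are compared at index `π ⟨$⟩ʳ i`.
    coordinates-unique-permuted : ∀ (π : Permutation′ n) x y →
                                  lc x (λ i → b (π ⟨$⟩ʳ i)) ≈ᴹ lc y (λ i → b (π ⟨$⟩ʳ i)) →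
                                  ∀ i → x i R.≈ y i
    coordinates-unique-permuted π x y x≈y i = R.trans (R.sym (unpermute x i)) (R.trans
      (coordinates-unique (λ i → x (π ⟨$⟩ˡ i)) (λ i → y (π ⟨$⟩ˡ i))
        (≈ᴹ-trans (permuted x) (≈ᴹ-trans x≈y (≈ᴹ-sym (permuted y)))) (π ⟨$⟩ʳ i))
      (unpermute y i))
      where
      unpermute : ∀ (z : Vector R.Carrier n) i → z (π ⟨$⟩ˡ (π ⟨$⟩ʳ i)) R.≈ z i
      unpermute z i = R.reflexive (≡.cong z (inverseˡ π))

      permuted : ∀ z → lc (λ i → z (π ⟨$⟩ˡ i)) b ≈ᴹ lc z (λ i → b (π ⟨$⟩ʳ i))
      permuted z = ≈ᴹ-trans (linearCombination-permute (λ i → z (π ⟨$⟩ˡ i)) b π)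
        (linearCombination-congˡ (unpermute z))

    -- For `i ≢ j`, comparing coordinates at `i` gives `sgn s ≈ 0#`, and squaring gives `1# ≈ 0#`.
    signedBasis-injective : R.1# R.≉ R.0# → ∀ {i j} s t → R.sgn s *ₗ b i ≈ᴹ R.sgn t *ₗ b j → i ≡ j
    signedBasis-injective 1≉0 {i} {j} s t si≈tj with i ≟ j
    ... | yes i≡j = i≡j
    ... | no i≢j  = contradiction 1≈0 1≉0
      where
      s≈0 : R.sgn s R.≈ R.0#
      s≈0 = R.trans (R.sym (single-≡ i (R.sgn s))) (R.trans
        (coordinates-unique (single i (R.sgn s)) (single j (R.sgn t)) (≈ᴹ-trans
          (linearCombination-single i (R.sgn s) b)
          (≈ᴹ-trans si≈tj (≈ᴹ-sym (linearCombination-single j (R.sgn t) b)))) i)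
        (single-≢ (R.sgn t) i≢j))

      1≈0 : R.1# R.≈ R.0#
      1≈0 = R.trans (R.sym (R.sgn-square s)) (R.trans (R.*-congʳ s≈0) (R.zeroˡ (R.sgn s)))

  -- Linear maps determined by their values on a basis

  module LinearMaps (M : Module R m ℓm) (N : Module R m₁ ℓm₁) where
    private
      module M where
        open Module M public
        open LinearCombinations M public
      module N where
        open Module N public
        open LinearCombinations N public
        open ModuleProperties N public using (inverseˡ-uniqueᴹ)

    module _ {φ : M.Carrierᴹ → N.Carrierᴹ} (φ-isLinear : IsModuleHomomorphism M.rawModule N.rawModule φ) where
      open IsModuleHomomorphism φ-isLinear

      linearCombination-homo : ∀ {n} (x : Vector R.Carrier n) v →
                               φ (linearCombination M x v) N.≈ᴹ linearCombination N x (φ ∘ v)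
      linearCombination-homo {zero}  x v = 0ᴹ-homo
      linearCombination-homo {suc n} x v = N.≈ᴹ-trans (+ᴹ-homo _ _)
        (N.+ᴹ-cong (*ₗ-homo _ _) (linearCombination-homo (x ∘ Fin.suc) (v ∘ Fin.suc)))

    module LinearExtension {n} {b : Vector M.Carrierᴹ n} (b-isBasis : IsBasis M b) (w : Vector N.Carrierᴹ n) where
      open Coordinates M b-isBasis
      open SetoidReasoning N.≈ᴹ-setoid

      extend : M.Carrierᴹ → N.Carrierᴹ
      extend v = linearCombination N (coordinates v) w

      -- By uniqueness any coordinates of `v` compute `extend v`, not just the chosen ones.
      -- Congruence, additivity, and compatibility with zero and left scalars are instances at
      -- suitable coordinates.
      extend-linearCombination : ∀ {v} x → v M.≈ᴹ linearCombination M x b → extend v N.≈ᴹ linearCombination N x w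
      extend-linearCombination {v} x v≈x = N.linearCombination-congˡ
        (coordinates-unique (coordinates v) x (M.≈ᴹ-trans (M.≈ᴹ-sym (coordinates-spec v)) v≈x))

      extend-basis : ∀ i → extend (b i) N.≈ᴹ w i
      extend-basis i = begin
        extend (b i)                              ≈⟨ extend-linearCombination (M.single i R.1#)
                                                       (M.≈ᴹ-sym (M.≈ᴹ-trans (M.linearCombination-single i R.1# b) (M.*ₗ-identityˡ (b i)))) ⟩
        linearCombination N (M.single i R.1#) w   ≈⟨ N.linearCombination-single i R.1# w ⟩
        R.1# N.*ₗ w i                             ≈⟨ N.*ₗ-identityˡ (w i) ⟩
        w i                                       ∎

      extend-cong : ∀ {u v} → u M.≈ᴹ v → extend u N.≈ᴹ extend v
      extend-cong {u} {v} u≈v = extend-linearCombination (coordinates v) (M.≈ᴹ-trans u≈v (coordinates-spec v))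

      extend-+ᴹ : ∀ u v → extend (u M.+ᴹ v) N.≈ᴹ extend u N.+ᴹ extend v
      extend-+ᴹ u v = N.≈ᴹ-trans
        (extend-linearCombination (λ i → coordinates u i R.+ coordinates v i)
          (M.≈ᴹ-trans (M.+ᴹ-cong (coordinates-spec u) (coordinates-spec v))
            (M.≈ᴹ-sym (M.linearCombination-+ (coordinates u) (coordinates v) b))))
        (N.linearCombination-+ (coordinates u) (coordinates v) w)

      extend-0ᴹ : extend M.0ᴹ N.≈ᴹ N.0ᴹ
      extend-0ᴹ = N.≈ᴹ-trans
        (extend-linearCombination (λ _ → R.0#) (M.≈ᴹ-sym (M.linearCombination-zero {v = b} λ _ → R.refl)))
        (N.linearCombination-zero {v = w} λ _ → R.refl)

      extend--ᴹ : ∀ v → extend (M.-ᴹ v) N.≈ᴹ N.-ᴹ extend v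
      extend--ᴹ v = N.inverseˡ-uniqueᴹ (extend (M.-ᴹ v)) (extend v) (begin
        extend (M.-ᴹ v) N.+ᴹ extend v   ≈⟨ extend-+ᴹ (M.-ᴹ v) v ⟨
        extend (M.-ᴹ v M.+ᴹ v)          ≈⟨ extend-cong (M.-ᴹ‿inverseˡ v) ⟩
        extend M.0ᴹ                     ≈⟨ extend-0ᴹ ⟩
        N.0ᴹ                            ∎)

      extend-*ₗ : ∀ s v → extend (s M.*ₗ v) N.≈ᴹ s N.*ₗ extend v
      extend-*ₗ s v = N.≈ᴹ-trans
        (extend-linearCombination (λ i → s R.* coordinates v i)
          (M.≈ᴹ-trans (M.*ₗ-congˡ (coordinates-spec v)) (M.*ₗ-linearCombination s (coordinates v) b)))
        (N.≈ᴹ-sym (N.*ₗ-linearCombination s (coordinates v) w))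

      extend-*ᵣ : ∀ s v → extend (v M.*ᵣ s) N.≈ᴹ extend v N.*ᵣ s
      extend-*ᵣ s v = begin
        extend (v M.*ᵣ s)   ≈⟨ extend-cong (M.*ₗ-*ᵣ-coincident s v) ⟨
        extend (s M.*ₗ v)   ≈⟨ extend-*ₗ s v ⟩
        s N.*ₗ extend v     ≈⟨ N.*ₗ-*ᵣ-coincident s (extend v) ⟩
        extend v N.*ᵣ s     ∎

      extend-isLinear : IsModuleHomomorphism M.rawModule N.rawModule extend
      extend-isLinear = record
        { isBimoduleHomomorphism = record
          { +ᴹ-isGroupHomomorphism = record
            { isMonoidHomomorphism = record
              { isMagmaHomomorphism = record
                { isRelHomomorphism = record { cong = extend-cong }
                ; homo              = extend-+ᴹ
                }
              ; ε-homo = extend-0ᴹ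
              }
            ; ⁻¹-homo = extend--ᴹ
            }
          ; *ₗ-homo = extend-*ₗ
          ; *ᵣ-homo = extend-*ᵣ
          }
        }

-- Consequences of characteristic zero

module _ {F : HeytingField c ℓ₁ ℓ₂} (charZero : CharacteristicZero F) where
  private
    module R where
      open CommutativeRing (fieldRing F) public hiding (zero)
      open RingNotation ring public
      open RingLemmas ring public

  1≉0 : R.1# R.≉ R.0#
  1≉0 1≈0 = contradiction (charZero 1 (R.trans (R.+-identityʳ R.1#) 1≈0)) λ ()

  -- This carries vanishing over `F` back to ℤ, from where it can be transported into the free ring.
  fromℤ-injective-0 : ∀ z → R.fromℤ z R.≈ R.0# → z ≡ 0ℤ
  fromℤ-injective-0 (+ n)    n≈0  = ≡.cong +_ (charZero n n≈0)
  fromℤ-injective-0 -[1+ n ] -n≈0 = contradiction (charZero (suc n) n≈0) λ ()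
    where
    open RingProperties R.ring using (-‿involutive; -0#≈0#)
    n≈0 = R.trans (R.sym (-‿involutive _)) (R.trans (R.-‿cong -n≈0) -0#≈0#)

  module _ {G : Group g ℓg} {C : Cocycle G} where
    private module G = Group G

    -- Group elements as signed permutations of the monomial basis

    module SignedPermutation (V : ProjectiveMonomialRepresentation F C m ℓm) where
      open ProjectiveMonomialRepresentation V
      open LinearCombinations space
      open Coordinates space isBasis
      open SetoidReasoning ≈ᴹ-setoid

      actSign : G.Carrier → Fin dim → Sign
      actSign x i = proj₁ (proj₂ (monomial x i))

      ρ-basis : ∀ x i → ρ x (basis i) ≈ᴹ R.sgn (actSign x i) *ₗ basis (act x i)
      ρ-basis x i = proj₂ (proj₂ (monomial x i))

      module _ (x : G.Carrier) where
        open IsModuleIsomorphism (ρ-isIsomorphism x) using (*ₗ-homo; injective)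

        -- Since signs square to 1, `ρ x` sends `basis i`, multiplied by its own sign, to exactly
        -- `basis (act x i)`. Injectivity of `ρ x` then reduces the claim to
        -- `signedBasis-injective`.
        act-injective : Injective _≡_ _≡_ (act x)
        act-injective {i} {j} xi≡xj =
          signedBasis-injective 1≉0 (actSign x i) (actSign x j) (injective (begin
            ρ x (R.sgn (actSign x i) *ₗ basis i)   ≈⟨ ρ-signedBasis i ⟩
            basis (act x i)                        ≡⟨ ≡.cong basis xi≡xj ⟩
            basis (act x j)                        ≈⟨ ρ-signedBasis j ⟨
            ρ x (R.sgn (actSign x j) *ₗ basis j)   ∎))
          where
          ρ-signedBasis : ∀ i → ρ x (R.sgn (actSign x i) *ₗ basis i) ≈ᴹ basis (act x i)
          ρ-signedBasis i = begin
            ρ x (R.sgn (actSign x i) *ₗ basis i)                              ≈⟨ *ₗ-homo _ (basis i) ⟩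
            R.sgn (actSign x i) *ₗ ρ x (basis i)                              ≈⟨ *ₗ-congˡ (ρ-basis x i) ⟩
            R.sgn (actSign x i) *ₗ (R.sgn (actSign x i) *ₗ basis (act x i))   ≈⟨ sgn-square-*ₗ (actSign x i) _ ⟩
            basis (act x i)                                                   ∎

        actPermutation : Permutation′ dim
        actPermutation = injective⇒permutation (act x) act-injective

    -- Morphisms as equivariant matrices

    module _ (V : ProjectiveMonomialRepresentation F C m ℓm) (V′ : ProjectiveMonomialRepresentation F C m′ ℓm′) where
      private
        module V where
          open ProjectiveMonomialRepresentation V public
          open SignedPermutation V public
          open LinearCombinations space public
          open Coordinates space isBasis public
        module V′ where
          open ProjectiveMonomialRepresentation V′ public
          open SignedPermutation V′ public
          open LinearCombinations space public
          open Coordinates space isBasis public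
      open LinearMaps V.space V′.space
      open SetoidReasoning V′.≈ᴹ-setoid

      -- T D = D′ T for the signed permutation matrices D and D′ of ρ x on V and V′, read off at the entry (x a , b).
      Equivariant : Matrix R.Carrier V′.dim V.dim → Set _
      Equivariant T = ∀ x a b → R.sgn (V.actSign x b) R.* T (V′.act x a) (V.act x b)
                                  R.≈ T a b R.* R.sgn (V′.actSign x a)

      module _ {T : Matrix R.Carrier V′.dim V.dim} {φ : V.Carrierᴹ → V′.Carrierᴹ}
               (φ-isLinear : IsModuleHomomorphism V.rawModule V′.rawModule φ)
               (φ-T : Represents V V′ T φ) where
        open IsModuleHomomorphism φ-isLinear using (⟦⟧-cong; *ₗ-homo)

        φ∘ρ-basis : ∀ x b → φ (V.ρ x (V.basis b)) V′.≈ᴹ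
          linearCombination V′.space (λ a → R.sgn (V.actSign x b) R.* T (V′.act x a) (V.act x b))
            (λ a → V′.basis (V′.act x a))
        φ∘ρ-basis x b = begin
          φ (V.ρ x (V.basis b))                                               ≈⟨ ⟦⟧-cong (V.ρ-basis x b) ⟩
          φ (ε V.*ₗ V.basis xb)                                               ≈⟨ *ₗ-homo ε _ ⟩
          ε V′.*ₗ φ (V.basis xb)                                              ≈⟨ V′.*ₗ-congˡ (φ-T xb) ⟩
          ε V′.*ₗ linearCombination V′.space (λ a → T a xb) V′.basis          ≈⟨ V′.*ₗ-linearCombination ε (λ a → T a xb) V′.basis ⟩
          -- Reindexing by `act x` reaches the permuted basis in which `ρ∘φ-basis` is expressed, so
          -- that coefficients can be compared.
          linearCombination V′.space (λ a → ε R.* T a xb) V′.basis            ≈⟨ V′.linearCombination-permute (λ a → ε R.* T a xb) V′.basis (V′.actPermutation x) ⟩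
          linearCombination V′.space (λ a → ε R.* T (V′.act x a) xb) (λ a → V′.basis (V′.act x a)) ∎
          where
          ε  = R.sgn (V.actSign x b)
          xb = V.act x b

        ρ∘φ-basis : ∀ x b → V′.ρ x (φ (V.basis b)) V′.≈ᴹ
          linearCombination V′.space (λ a → T a b R.* R.sgn (V′.actSign x a)) (λ a → V′.basis (V′.act x a))
        ρ∘φ-basis x b = begin
          V′.ρ x (φ (V.basis b))                                              ≈⟨ ρ.⟦⟧-cong (φ-T b) ⟩
          V′.ρ x (linearCombination V′.space (λ a → T a b) V′.basis)          ≈⟨ LinearMaps.linearCombination-homo V′.space V′.space ρ.isModuleHomomorphism (λ a → T a b) V′.basis ⟩
          linearCombination V′.space (λ a → T a b) (λ a → V′.ρ x (V′.basis a)) ≈⟨ V′.linearCombination-congʳ (V′.ρ-basis x) ⟩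
          linearCombination V′.space (λ a → T a b) (λ a → ε a V′.*ₗ V′.basis (V′.act x a)) ≈⟨ V′.linearCombination-*ₗ (λ a → T a b) ε (λ a → V′.basis (V′.act x a)) ⟩
          linearCombination V′.space (λ a → T a b R.* ε a) (λ a → V′.basis (V′.act x a)) ∎
          where
          module ρ = IsModuleIsomorphism (V′.ρ-isIsomorphism x)
          ε = λ a → R.sgn (V′.actSign x a)

      -- Commutation with `ρ x` at a basis vector equates two combinations of the same permuted
      -- basis; their coefficients are the two sides of equivariance.
      HomM⇒Equivariant : ∀ {T} → HomM V V′ T → Equivariant T
      HomM⇒Equivariant {T} (φ , φ-isMorphism , φ-T) x a b =
        V′.coordinates-unique-permuted (V′.actPermutation x)
          (λ a → R.sgn (V.actSign x b) R.* T (V′.act x a) (V.act x b))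
          (λ a → T a b R.* R.sgn (V′.actSign x a))
          (V′.≈ᴹ-trans (V′.≈ᴹ-sym (φ∘ρ-basis isLinear φ-T x b))
            (V′.≈ᴹ-trans (commutes x (V.basis b)) (ρ∘φ-basis isLinear φ-T x b))) a
        where open IsMorphism φ-isMorphism

      -- The morphism is the linear extension of the columns of `T`. Equivariance makes it commute
      -- with `ρ x` on basis vectors, and linearity of both composites does the rest.
      Equivariant⇒HomM : ∀ {T} → Equivariant T → HomM V V′ T
      Equivariant⇒HomM {T} T-equivariant =
        φ , record { isLinear = extend-isLinear ; commutes = commutes } , extend-basis
        where
        open LinearExtension V.isBasis (λ b → linearCombination V′.space (λ a → T a b) V′.basis)
          renaming (extend to φ; extend-cong to φ-cong)

        commutes-basis : ∀ x b → φ (V.ρ x (V.basis b)) V′.≈ᴹ V′.ρ x (φ (V.basis b))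
        commutes-basis x b = V′.≈ᴹ-trans (φ∘ρ-basis extend-isLinear extend-basis x b)
          (V′.≈ᴹ-trans (V′.linearCombination-congˡ (λ a → T-equivariant x a b))
            (V′.≈ᴹ-sym (ρ∘φ-basis extend-isLinear extend-basis x b)))

        commutes : ∀ x v → φ (V.ρ x v) V′.≈ᴹ V′.ρ x (φ v)
        commutes x v = begin
          φ (V.ρ x v)                                                         ≈⟨ φ-cong (ρ.⟦⟧-cong (V.coordinates-spec v)) ⟩
          φ (V.ρ x (linearCombination V.space y V.basis))                     ≈⟨ φ-cong (ρ-homo y V.basis) ⟩
          φ (linearCombination V.space y (V.ρ x ∘ V.basis))                   ≈⟨ linearCombination-homo extend-isLinear y (V.ρ x ∘ V.basis) ⟩
          linearCombination V′.space y (φ ∘ V.ρ x ∘ V.basis)                  ≈⟨ V′.linearCombination-congʳ (commutes-basis x) ⟩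
          linearCombination V′.space y (V′.ρ x ∘ φ ∘ V.basis)                 ≈⟨ ρ′-homo y (φ ∘ V.basis) ⟨
          V′.ρ x (linearCombination V′.space y (φ ∘ V.basis))                 ≈⟨ ρ′.⟦⟧-cong (linearCombination-homo extend-isLinear y V.basis) ⟨
          V′.ρ x (φ (linearCombination V.space y V.basis))                    ≈⟨ ρ′.⟦⟧-cong (φ-cong (V.coordinates-spec v)) ⟨
          V′.ρ x (φ v)                                                        ∎
          where
          module ρ  = IsModuleIsomorphism (V.ρ-isIsomorphism x)
          module ρ′ = IsModuleIsomorphism (V′.ρ-isIsomorphism x)
          y = V.coordinates v
          ρ-homo  = λ {n} → LinearMaps.linearCombination-homo V.space V.space ρ.isModuleHomomorphism {n}
          ρ′-homo = λ {n} → LinearMaps.linearCombination-homo V′.space V′.space ρ′.isModuleHomomorphism {n}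

    -- Orthogonality of the two Hom spaces

    module _ (W : ProjectiveMonomialRepresentation F C m₀ ℓm₀)
             (V : ProjectiveMonomialRepresentation F C m₁ ℓm₁)
             (V′ : ProjectiveMonomialRepresentation F C m₂ ℓm₂) where
      private
        module W where
          open ProjectiveMonomialRepresentation W public
          open SignedPermutation W public
        module V where
          open ProjectiveMonomialRepresentation V public
          open SignedPermutation V public
        module V′ where
          open ProjectiveMonomialRepresentation V′ public
          open SignedPermutation V′ public
      open SemiringSum R.semiring using (sum-cong-≋; *-distribˡ-sum; *-distribʳ-sum; sum-permute)
      open RingNotation ℤ.+-*-ring using () renaming (_*ᵀ_ to _ℤ*ᵀ_)
      open SetoidReasoning R.setoid

      -- With `D` denoting the signed permutation matrices of `x`, transposing `S D_W = D_V S` and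
      -- using orthogonality gives `Sᵀ D_V = D_W Sᵀ`, whence `T Sᵀ D_V = T D_W Sᵀ = D_V′ T Sᵀ`.
      -- Entrywise, orthogonality becomes reindexing by `W.act x` together with signs squaring to 1.
      *ᵀ-equivariant : ∀ {S T} → Equivariant W V S → Equivariant W V′ T → Equivariant V V′ (T R.*ᵀ S)
      *ᵀ-equivariant {S} {T} S-equivariant T-equivariant x a b = begin
        ε * sum (λ j → T xa j * S xb j)                     ≈⟨ *-congˡ (sum-permute (λ j → T xa j * S xb j) (W.actPermutation x)) ⟩
        ε * sum (λ j → T xa (W.act x j) * S xb (W.act x j)) ≈⟨ *-distribˡ-sum ε (λ j → T xa (W.act x j) * S xb (W.act x j)) ⟩
        sum (λ j → ε * (T xa (W.act x j) * S xb (W.act x j))) ≈⟨ sum-cong-≋ move-signs ⟩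
        sum (λ j → T a j * S b j * ε′)                      ≈⟨ *-distribʳ-sum ε′ (λ j → T a j * S b j) ⟨
        sum (λ j → T a j * S b j) * ε′                      ∎
        where
        open R using (_*_; *-congˡ; *-congʳ; *-cong; sum; 1#; sgn; sgn-square; *-identityˡ; *-commutativeMonoid)
        open CommutativeMonoidSolver *-commutativeMonoid
        xa = V′.act x a
        xb = V.act x b
        ε  = sgn (V.actSign x b)
        ε′ = sgn (V′.actSign x a)

        move-signs : ∀ j → ε * (T xa (W.act x j) * S xb (W.act x j)) R.≈ T a j * S b j * ε′
        move-signs j = begin
          ε * (t * s)                   ≈⟨ *-identityˡ _ ⟨
          -- The inserted `δ * δ` supplies one sign of `W` to each of the two equivariance
          -- equations.
          1# * (ε * (t * s))            ≈⟨ *-congʳ (sgn-square (W.actSign x j)) ⟨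
          δ * δ * (ε * (t * s))         ≈⟨ solve 4 (λ δ ε t s → (δ ⊕ δ) ⊕ (ε ⊕ (t ⊕ s)) ⊜ ε ⊕ ((δ ⊕ t) ⊕ (δ ⊕ s))) R.refl δ ε t s ⟩
          ε * (δ * t * (δ * s))         ≈⟨ *-congˡ (*-cong (T-equivariant x a j) (S-equivariant x b j)) ⟩
          -- The equation for `S` contributes a second `ε`, which cancels the first and leaves only
          -- `ε′`.
          ε * (T a j * ε′ * (S b j * ε)) ≈⟨ solve 4 (λ ε ε′ t s → ε ⊕ ((t ⊕ ε′) ⊕ (s ⊕ ε)) ⊜ (ε ⊕ ε) ⊕ ((t ⊕ s) ⊕ ε′)) R.refl ε ε′ (T a j) (S b j) ⟩
          ε * ε * (T a j * S b j * ε′)  ≈⟨ *-congʳ (sgn-square (V.actSign x b)) ⟩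
          1# * (T a j * S b j * ε′)     ≈⟨ *-identityˡ _ ⟩
          T a j * S b j * ε′            ∎
          where
          δ = sgn (W.actSign x j)
          t = T xa (W.act x j)
          s = S xb (W.act x j)

      HomM-orthogonal : HomMIsZero V V′ → ∀ S T → HomM W V (R.fromMatrixℤ S) → HomM W V′ (R.fromMatrixℤ T) →
                        ∀ a b → (S ℤ*ᵀ T) a b ≡ 0ℤ
      HomM-orthogonal hom≡0 S T S∈HomM T∈HomM a b = fromℤ-injective-0 _ (begin
        R.fromℤ ((S ℤ*ᵀ T) a b)                             ≈⟨ R.fromℤ-homo-*ᵀ S T a b ⟩
        -- Commutativity of `F` turns entry `(a , b)` of `S Tᵀ` into entry `(b , a)` of `T Sᵀ`,
        -- which represents a morphism from `V` to `V′`. The free ring has no such swap, so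
        -- vanishing is first settled over `F`.
        (R.fromMatrixℤ S R.*ᵀ R.fromMatrixℤ T) a b          ≈⟨ sum-cong-≋ (λ j → R.*-comm (R.fromℤ (S a j)) (R.fromℤ (T b j))) ⟩
        (R.fromMatrixℤ T R.*ᵀ R.fromMatrixℤ S) b a          ≈⟨ hom≡0 (Equivariant⇒HomM V V′ (*ᵀ-equivariant
                                                                 (HomM⇒Equivariant W V S∈HomM) (HomM⇒Equivariant W V′ T∈HomM))) b a ⟩
        R.0#                                                ∎)

-- The formal orthogonal pair

corollary2p10 :
  ∀ {c ℓ₁ ℓ₂ g ℓg m₀ ℓm₀ m₁ ℓm₁ m₂ ℓm₂ : Level}
  (F : HeytingField c ℓ₁ ℓ₂) → CharacteristicZero F →
  (G : Group g ℓg) → IsFinite G →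
  (ω : Cocycle G)
  (W : ProjectiveMonomialRepresentation F ω m₀ ℓm₀)
  (V : ProjectiveMonomialRepresentation F ω m₁ ℓm₁)
  (V′ : ProjectiveMonomialRepresentation F ω m₂ ℓm₂) →
  HomMIsZero V V′ →
  let module W = ProjectiveMonomialRepresentation W
      module V = ProjectiveMonomialRepresentation V
      module V′ = ProjectiveMonomialRepresentation V′
  in
  (r s : ℕ)
  (P : Vector (Matrix ℤ V.dim W.dim) r)
  (Q : Vector (Matrix ℤ V′.dim W.dim) s) →
  IsHomMBasis W V P →
  (∀ i → IsSignMatrix (P i)) →
  DisjointSupports P →
  (∀ i → SupportedOnOrbit W V (P i)) →
  IsHomMBasis W V′ Q →
  (∀ j → IsSignMatrix (Q j)) →
  DisjointSupports Q →
  (∀ j → SupportedOnOrbit W V′ (Q j)) →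
  let open RingNotation (freeRing (Fin r ⊎ Fin s)) using (formalSum)
      x = λ (i : Fin r) → var (inj₁ i)
      y = λ (j : Fin s) → var (inj₂ j)
  in
  IsFormalOrthogonalPair r s (formalSum x P) (formalSum y Q)
corollary2p10 F charZero G _ ω W V V′ hom≡0 r s P Q P-basis P-sign P-disjoint _ Q-basis Q-sign Q-disjoint _ = record
  { entriesˡ   = formalSum-signedSymbolOrZero r s x P P-sign P-disjoint
  ; entriesʳ   = formalSum-signedSymbolOrZero r s y Q Q-sign Q-disjoint
  -- After expansion, the coefficient of each `x i * y j` is an integer entry of `P i` times the
  -- transpose of `Q j`, so the double sum vanishes term by term.
  ; orthogonal = λ a b → trans (formalSum-*ᵀ x y P Q a b)
      (sum-zero +-commutativeMonoid λ i → sum-zero +-commutativeMonoid λ j →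
        *-fromℤ-zero (x i * y j) (PQᵀ≡0 i j a b))
  }
  where
  open Ring (freeRing (Fin r ⊎ Fin s)) using (_*_; trans; +-commutativeMonoid)
  open RingLemmas (freeRing (Fin r ⊎ Fin s)) using (*-fromℤ-zero; formalSum-*ᵀ)
  x = λ (i : Fin r) → var (inj₁ i)
  y = λ (j : Fin s) → var (inj₂ j)
  PQᵀ≡0 = λ i j → HomM-orthogonal charZero W V V′ hom≡0 (P i) (Q j) (IsBasisOf.members P-basis i) (IsBasisOf.members Q-basis j)
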